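{- If $\mathrm{GDC}_{A,B,T}$ holds for all types $A,B$ and all downward prime $T:\mathcal P((A\times B)^*)$, then $\exists\mathrm{MPCF}^-_{A,B,T}$ holds for all types $A,B$ and all downward prime $T:\mathcal P((A\times B)^*)$.
   Context: Setting: intuitionistic higher-order arithmetic with inductive types and extensional equality of predicates; no choice principle is assumed. $\mathcal P(A)$ denotes $A\to\mathrm{Prop}$, with $a\in P$ meaning $P(a)$. $A^*$ is the type of finite lists over $A$, $\varepsilon$ the empty list, $u@a$ the list $u$ with $a$ appended at the end, $\star$ concatenation; $a\in u$ means $a$ occurs in $u$. For $u:A^*$, $\alpha:\mathcal P(A)$, $u\subset\alpha$ means $\forall a,\ a\in u\to a\in\alpha$; a list $u$ determines the predicate $\langle u\rangle:=\lambda x.\,x\in u$. For $T:\mathcal P(A^*)$, $\langle T\rangle:=\{\alpha:\mathcal P(A)\mid\forall u^{A^*},\ u\subset\alpha\to u\in T\}$. For $P:\mathcal P(\mathcal P(A))$, $\lfloor P\rfloor:=\{u:A^*\mid\langle u\rangle\in P\}$. Downward prime: $T:\mathcal P((A\times B)^*)$ is downward prime when $u\in T$ and $v\in T$ implies $u\star v\in T$. $\mathrm{GDC}$: let $A,B$ be types and $T:\mathcal P((A\times B)^*)$. For $X:\mathcal P((A\times B)^*)$ put $\phi(X):=\{u\mid u\in\lfloor\langle T\rangle\rfloor\wedge\forall a^A,\ \neg(\exists b^B,\ (a,b)\in u)\to\exists b^B,\ u@(a,b)\in X\}$; $T_{AB\mathrm{ap}}$ is the greatest fixed point of $\phi$.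 $T$ is $A$-$B$-approximable if $\varepsilon\in T_{AB\mathrm{ap}}$. $T$ has an $A$-$B$-choice function if there is $f:A\to B$ such that every $u:(A\times B)^*$ with $u\subset\mathcal G(f)$ is in $T$, where $\mathcal G(f)=\{(a,b)\mid f(a)=b\}$. $\mathrm{GDC}_{A,B,T}$ is: if $T$ is $A$-$B$-approximable then $T$ has an $A$-$B$-choice function. $\exists\mathrm{MPCF}^-$: a relational partial function from $A$ to $B$ is $f:\mathcal P(A\times B)$ such that $(a,b)\in f$ and $(a,b')\in f$ imply $b=b'$; $\mathrm{dom}(f):=\lambda a.\,\exists b,\ (a,b)\in f$. For relational partial functions $f,g$ from $A$ to $B$, $g\prec f$ means there is $a:A$ with $a\notin\mathrm{dom}(f)$, $\mathrm{dom}(g)=\lambda x.\,(x\in\mathrm{dom}(f)\vee x=a)$, and for all $x\in\mathrm{dom}(f)$ there is $b:B$ with $(x,b)\in f$ and $(x,b)\in g$. $f\in\mathrm{Max}_{\mathrm{rpf}}(P)$ means $f\in P$ and for every relational partial function $g$ from $A$ to $B$, $g\prec f\to g\notin P$. $\exists\mathrm{MPCF}^-_{A,B,T}$ is: $(\exists\alpha^{\mathcal P(A\times B)},\ \alpha\in\langle T\rangle)\to$ there is a relational partial function $f$ from $A$ to $B$ with $f\in\mathrm{Max}_{\mathrm{rpf}}(\langle T\rangle)$. -}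

module Defs where

open import Data.Empty.Polymorphic using () renaming (⊥ to Empty)
open import Data.List.Base using (List; []; _++_; _∷ʳ_)
import Data.List.Membership.Propositional as List
open import Data.Product.Base using (Σ-syntax; _×_; _,_)
open import Data.Sum.Base using (_⊎_)
open import Level using (Level; suc)
open import Relation.Binary.PropositionalEquality.Core using (_≡_)

-- The sort Prop of higher-order logic over the types Set ℓ: a universe of
-- proof-irrelevant propositions closed under impredicative quantification.
-- Since Ω and Prf P are themselves types in Set ℓ, the single closure
-- condition covers quantification over predicates and implication, and the
-- other connectives are definable from it.
--
-- Agda's own Σ is not used as the existential quantifier of the logic because
-- it would make the axiom of choice provable.  Nothing below allows a proof of
-- an existential statement to be turned into a function returning witnesses.

record PropUniverse (ℓ : Level) : Set (suc ℓ) where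
  field
    Ω          : Set ℓ
    Prf        : Ω → Set ℓ
    irrelevant : (P : Ω) (p q : Prf P) → p ≡ q
    Π          : (A : Set ℓ) → (A → Ω) → Ω
    Π-intro    : {A : Set ℓ} {P : A → Ω} → ((x : A) → Prf (P x)) → Prf (Π A P)
    Π-elim     : {A : Set ℓ} {P : A → Ω} → Prf (Π A P) → (x : A) → Prf (P x)

module Logic {ℓ : Level} (𝒰 : PropUniverse ℓ) where

  open PropUniverse 𝒰 public

  infix  4 _≐_ _∈_ _∈ˡ_ _⊂_ _⊆_ _≈_
  infix  3 ¬_
  infixr 2 _∧_
  infixr 1 _∨_
  infixr 0 _⇒_
  infix -1 Π-syntax ∃-syntax

  Π-syntax : (A : Set ℓ) → (A → Ω) → Ω
  Π-syntax = Π

  syntax Π-syntax A (λ x → P) = ∀[ x ∶ A ] P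

  _⇒_ : Ω → Ω → Ω
  P ⇒ Q = Π (Prf P) (λ _ → Q)

  -- ∥ X ∥ is the proposition that X is inhabited.

  ∥_∥ : Set ℓ → Ω
  ∥ X ∥ = ∀[ Q ∶ Ω ] (∀[ _ ∶ X ] Q) ⇒ Q

  ⊥ : Ω
  ⊥ = ∥ Empty ∥

  ¬_ : Ω → Ω
  ¬ P = P ⇒ ⊥

  _∧_ : Ω → Ω → Ω
  P ∧ Q = ∥ Prf P × Prf Q ∥

  _∨_ : Ω → Ω → Ω
  P ∨ Q = ∥ Prf P ⊎ Prf Q ∥

  ∃ : (A : Set ℓ) → (A → Ω) → Ω
  ∃ A P = ∥ Σ[ x ∈ A ] Prf (P x) ∥

  ∃-syntax : (A : Set ℓ) → (A → Ω) → Ω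
  ∃-syntax = ∃

  syntax ∃-syntax A (λ x → P) = ∃[ x ∶ A ] P

  _≐_ : {A : Set ℓ} → A → A → Ω
  x ≐ y = ∥ x ≡ y ∥

  𝒫 : Set ℓ → Set ℓ
  𝒫 A = A → Ω

  _∈_ : {A : Set ℓ} → A → 𝒫 A → Ω
  x ∈ P = P x

  _∈ˡ_ : {A : Set ℓ} → A → List A → Ω
  x ∈ˡ u = ∥ x List.∈ u ∥

  _⊆_ : {A : Set ℓ} → 𝒫 A → 𝒫 A → Ω
  _⊆_ {A} P Q = ∀[ x ∶ A ] x ∈ P ⇒ x ∈ Q

  -- Equality of predicates is extensional.

  _≈_ : {A : Set ℓ} → 𝒫 A → 𝒫 A → Ω
  P ≈ Q = P ⊆ Q ∧ Q ⊆ P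

  _⊂_ : {A : Set ℓ} → List A → 𝒫 A → Ω
  _⊂_ {A} u α = ∀[ x ∶ A ] x ∈ˡ u ⇒ x ∈ α

  ⟨_⟩ˡ : {A : Set ℓ} → List A → 𝒫 A
  ⟨ u ⟩ˡ = λ x → x ∈ˡ u

  ⟨_⟩ : {A : Set ℓ} → 𝒫 (List A) → 𝒫 (𝒫 A)
  ⟨_⟩ {A} T = λ α → ∀[ u ∶ List A ] u ⊂ α ⇒ u ∈ T

  ⌊_⌋ : {A : Set ℓ} → 𝒫 (𝒫 A) → 𝒫 (List A)
  ⌊ P ⌋ = λ u → ⟨ u ⟩ˡ ∈ P

  -- Knaster–Tarski: for monotone F, the union of all post-fixed points of F.

  gfp : {A : Set ℓ} → (𝒫 A → 𝒫 A) → 𝒫 A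
  gfp {A} F = λ x → ∃[ X ∶ 𝒫 A ] X ⊆ F X ∧ x ∈ X

  module _ {A B : Set ℓ} where

    DownwardPrime : 𝒫 (List (A × B)) → Ω
    DownwardPrime T =
      ∀[ u ∶ List (A × B) ] ∀[ v ∶ List (A × B) ] u ∈ T ⇒ v ∈ T ⇒ u ++ v ∈ T

    φ : 𝒫 (List (A × B)) → 𝒫 (List (A × B)) → 𝒫 (List (A × B))
    φ T X = λ u → u ∈ ⌊ ⟨ T ⟩ ⌋
                ∧ (∀[ a ∶ A ] ¬ (∃[ b ∶ B ] (a , b) ∈ˡ u) ⇒ (∃[ b ∶ B ] u ∷ʳ (a , b) ∈ X))

    Tap : 𝒫 (List (A × B)) → 𝒫 (List (A × B))
    Tap T = gfp (φ T)

    Approximable : 𝒫 (List (A × B)) → Ω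
    Approximable T = [] ∈ Tap T

    𝒢 : (A → B) → 𝒫 (A × B)
    𝒢 f (a , b) = f a ≐ b

    HasChoiceFunction : 𝒫 (List (A × B)) → Ω
    HasChoiceFunction T = ∃[ f ∶ (A → B) ] ∀[ u ∶ List (A × B) ] u ⊂ 𝒢 f ⇒ u ∈ T

    GDC : 𝒫 (List (A × B)) → Ω
    GDC T = Approximable T ⇒ HasChoiceFunction T

    Functional : 𝒫 (A × B) → Ω
    Functional f =
      ∀[ a ∶ A ] ∀[ b ∶ B ] ∀[ b′ ∶ B ] (a , b) ∈ f ⇒ (a , b′) ∈ f ⇒ b ≐ b′

  record RPF (A B : Set ℓ) : Set ℓ where
    field
      graph      : 𝒫 (A × B)
      functional : Prf (Functional graph)

  open RPF public

  module _ {A B : Set ℓ} where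

    infix 4 _≺_

    dom : RPF A B → 𝒫 A
    dom f = λ a → ∃[ b ∶ B ] (a , b) ∈ graph f

    _≺_ : RPF A B → RPF A B → Ω
    g ≺ f = ∃[ a ∶ A ] ¬ (a ∈ dom f)
                     ∧ dom g ≈ (λ x → x ∈ dom f ∨ x ≐ a)
                     ∧ (∀[ x ∶ A ] x ∈ dom f ⇒ (∃[ b ∶ B ] (x , b) ∈ graph f ∧ (x , b) ∈ graph g))

    Maxʳᵖᶠ : 𝒫 (𝒫 (A × B)) → 𝒫 (RPF A B)
    Maxʳᵖᶠ P = λ f → graph f ∈ P ∧ (∀[ g ∶ RPF A B ] g ≺ f ⇒ ¬ (graph g ∈ P))

    ∃MPCF⁻ : 𝒫 (List (A × B)) → Ω
    ∃MPCF⁻ T = (∃[ α ∶ 𝒫 (A × B) ] α ∈ ⟨ T ⟩) ⇒ (∃[ f ∶ RPF A B ] f ∈ Maxʳᵖᶠ ⟨ T ⟩)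

{-# OPTIONS --safe #-}
-- For a downward prime T containing the empty list, α ∈ ⟨T⟩ just says that
-- [ x ] ∈ T for every x ∈ α, so T amounts to the relation R (a , b) = [ (a , b) ] ∈ T.
-- Applied to the lists contained in a total relation, GDC is the axiom of choice.
-- A choice function for R on the subtype of those a related to some b is a relational
-- partial function on A whose domain already contains everything that R can reach,
-- so no proper extension of it lies in ⟨T⟩.
module Submission where

open import Defs
open import Data.List.Base using (List; []; _∷_; [_]; _++_)
open import Data.List.Membership.Propositional.Properties using (∈-++⁻)
open import Data.List.Relation.Unary.Any using (here; there)
open import Data.Product.Base using (Σ-syntax; _×_; _,_; proj₁)
open import Data.Sum.Base using (inj₁; inj₂; [_,_]′)
open import Function.Base using (_∘_)
open import Level using (Level)
open import Relation.Binary.PropositionalEquality.Core using (refl; sym; trans; cong; subst)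

module Choice {ℓ : Level} (𝒰 : PropUniverse ℓ) where

  open Logic 𝒰

  private variable
    A B X : Set ℓ

  ⇒-intro : {P Q : Ω} → (Prf P → Prf Q) → Prf (P ⇒ Q)
  ⇒-intro = Π-intro

  ⇒-elim : {P Q : Ω} → Prf (P ⇒ Q) → Prf P → Prf Q
  ⇒-elim = Π-elim

  ∥∥-intro : X → Prf ∥ X ∥
  ∥∥-intro x = Π-intro λ Q → ⇒-intro λ h → Π-elim h x

  ∥∥-elim : (Q : Ω) → Prf ∥ X ∥ → (X → Prf Q) → Prf Q
  ∥∥-elim Q p k = ⇒-elim (Π-elim p Q) (Π-intro k)

  ⊂-intro : {u : List X} {α : 𝒫 X} → (∀ x → Prf (x ∈ˡ u) → Prf (x ∈ α)) → Prf (u ⊂ α)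
  ⊂-intro h = Π-intro λ x → ⇒-intro (h x)

  ⊂-elim : {u : List X} {α : 𝒫 X} → Prf (u ⊂ α) → ∀ {x} → Prf (x ∈ˡ u) → Prf (x ∈ α)
  ⊂-elim h {x} = ⇒-elim (Π-elim h x)

  []-⊂ : (α : 𝒫 X) → Prf ([] ⊂ α)
  []-⊂ α = ⊂-intro λ x x∈[] → ∥∥-elim (x ∈ α) x∈[] λ ()

  [-]-⊂ : (α : 𝒫 X) {x : X} → Prf (x ∈ α) → Prf ([ x ] ⊂ α)
  [-]-⊂ α x∈α = ⊂-intro λ y y∈[x] → ∥∥-elim (y ∈ α) y∈[x] λ { (here refl) → x∈α }

  ++-⊂ : (α : 𝒫 X) {u v : List X} → Prf (u ⊂ α) → Prf (v ⊂ α) → Prf (u ++ v ⊂ α)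
  ++-⊂ α {u} u⊂α v⊂α = ⊂-intro λ x x∈u++v → ∥∥-elim (x ∈ α) x∈u++v λ i →
    [ ⊂-elim u⊂α ∘ ∥∥-intro , ⊂-elim v⊂α ∘ ∥∥-intro ]′ (∈-++⁻ u i)

  ⟨⟩-intro : {T : 𝒫 (List X)} {α : 𝒫 X} → (∀ u → Prf (u ⊂ α) → Prf (u ∈ T)) → Prf (α ∈ ⟨ T ⟩)
  ⟨⟩-intro h = Π-intro λ u → ⇒-intro (h u)

  ⟨⟩-elim : {T : 𝒫 (List X)} {α : 𝒫 X} → Prf (α ∈ ⟨ T ⟩) → ∀ {u} → Prf (u ⊂ α) → Prf (u ∈ T)
  ⟨⟩-elim h {u} = ⇒-elim (Π-elim h u)

  DownwardPrime-intro : {T : 𝒫 (List (A × B))} →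
    (∀ {u v} → Prf (u ∈ T) → Prf (v ∈ T) → Prf (u ++ v ∈ T)) → Prf (DownwardPrime T)
  DownwardPrime-intro h =
    Π-intro λ u → Π-intro λ v → ⇒-intro λ p → ⇒-intro λ q → h p q

  DownwardPrime-elim : {T : 𝒫 (List (A × B))} → Prf (DownwardPrime T) →
    ∀ {u v} → Prf (u ∈ T) → Prf (v ∈ T) → Prf (u ++ v ∈ T)
  DownwardPrime-elim h {u} {v} p q = ⇒-elim (⇒-elim (Π-elim (Π-elim h u) v) p) q

  -- By induction: a list within `α` is a concatenation of singletons, each in `T` by assumption,
  -- and `[]∈T` starts the induction.
  downwardPrime-pointwise : {T : 𝒫 (List (A × B))} → Prf (DownwardPrime T) → Prf ([] ∈ T) →
    {α : 𝒫 (A × B)} → (∀ x → Prf (x ∈ α) → Prf ([ x ] ∈ T)) → Prf (α ∈ ⟨ T ⟩)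
  downwardPrime-pointwise {T = T} prime []∈T {α} h = ⟨⟩-intro go
    where
    go : ∀ u → Prf (u ⊂ α) → Prf (u ∈ T)
    go []      _     = []∈T
    go (x ∷ u) xu⊂α = DownwardPrime-elim {T = T} prime
      (h x (⊂-elim xu⊂α (∥∥-intro (here refl))))
      (go u (⊂-intro λ y y∈u → ∥∥-elim (y ∈ α) y∈u (⊂-elim xu⊂α ∘ ∥∥-intro ∘ there)))

  -- The predicate `_⊂ R` is itself a post-fixed point of `φ`: totality supplies a pair of `R` to
  -- append at any `a`.
  ⊂-approximable : (R : 𝒫 (A × B)) → (∀ a → Prf (∃[ b ∶ B ] (a , b) ∈ R)) →
    Prf (Approximable (_⊂ R))
  ⊂-approximable {A} {B} R total =
    ∥∥-intro (T , ∥∥-intro (Π-intro (λ u → ⇒-intro (postfixed u)) , []-⊂ R))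
    where
    T : 𝒫 (List (A × B))
    T = _⊂ R

    postfixed : ∀ u → Prf (u ∈ T) → Prf (u ∈ φ T T)
    postfixed u u⊂R = ∥∥-intro
      ( ⟨⟩-intro {T = T} (λ v v⊂u → ⊂-intro λ x x∈v → ⊂-elim u⊂R (⊂-elim v⊂u x∈v))
      , Π-intro λ a → ⇒-intro λ _ → ∥∥-elim _ (total a) λ (b , ab∈R) →
          ∥∥-intro (b , ++-⊂ R u⊂R ([-]-⊂ R ab∈R)))

  -- The list `[ (a , f a) ]` lies in the graph of the choice function `f`, hence within `R`, and so
  -- does its only entry.
  choice : (R : 𝒫 (A × B)) → Prf (GDC (_⊂ R)) → (∀ a → Prf (∃[ b ∶ B ] (a , b) ∈ R)) →
    Prf (∃[ f ∶ (A → B) ] ∀[ a ∶ A ] (a , f a) ∈ R)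
  choice R gdc total = ∥∥-elim _ (⇒-elim gdc (⊂-approximable R total)) λ (f , f∈⟨R⟩) →
    ∥∥-intro (f , Π-intro λ a →
      ⊂-elim (⟨⟩-elim {T = _⊂ R} f∈⟨R⟩ ([-]-⊂ (𝒢 f) (∥∥-intro refl))) (∥∥-intro (here refl)))

  module _ (T : 𝒫 (List (A × B))) where

    Extendable : A → Ω
    Extendable a = ∃[ b ∶ B ] [ (a , b) ] ∈ T

    -- Each element carries its own proof of extendability, which makes `onSupport` total.
    Support : Set ℓ
    Support = Σ[ a ∈ A ] Prf (Extendable a)

    onSupport : 𝒫 (Support × B)
    onSupport (s , b) = [ (proj₁ s , b) ] ∈ T

    -- Quantifying over the proof `p` gives a predicate on all of `A × B` without deciding which `a`
    -- are extendable.
    partial : (Support → B) → RPF A B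
    partial f .graph (a , b) = ∃[ p ∶ Prf (Extendable a) ] f (a , p) ≐ b
    partial f .functional =
      Π-intro λ a → Π-intro λ b → Π-intro λ b′ → ⇒-intro λ m → ⇒-intro λ m′ →
      ∥∥-elim _ m λ (p , e) → ∥∥-elim _ m′ λ (p′ , e′) →
      ∥∥-elim _ e λ fp≡b → ∥∥-elim _ e′ λ fp′≡b′ →
      -- Irrelevance identifies `(a , p)` with `(a , p′)`, so `f` has a single value over `a`.
      ∥∥-intro (trans (sym fp≡b)
        (trans (cong (λ q → f (a , q)) (irrelevant (Extendable a) p p′)) fp′≡b′))

    partial∈⟨⟩ : Prf (DownwardPrime T) → Prf ([] ∈ T) →
      (f : Support → B) → (∀ s → Prf ((s , f s) ∈ onSupport)) → Prf (graph (partial f) ∈ ⟨ T ⟩)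
    partial∈⟨⟩ prime []∈T f f∈T = downwardPrime-pointwise prime []∈T λ (a , b) m →
      ∥∥-elim _ m λ (p , e) → ∥∥-elim _ e λ fp≡b →
      subst (λ c → Prf ([ (a , c) ] ∈ T)) fp≡b (f∈T (a , p))

    -- The new point `a` is paired with some `b` in `g`, so `[ (a , b) ]` is in `T`. Hence `a` is
    -- extendable and was in the domain of `partial f` already.
    partial-maximal : (f : Support → B) (g : RPF A B) →
      Prf (g ≺ partial f) → Prf (graph g ∈ ⟨ T ⟩) → Prf ⊥
    partial-maximal f g g≺f g∈T =
      ∥∥-elim ⊥ g≺f λ (a , h) →
      ∥∥-elim ⊥ h λ (a∉dom , h′) →
      ∥∥-elim ⊥ h′ λ (dom≈ , _) →
      ∥∥-elim ⊥ dom≈ λ (_ , ⊆dom-g) →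
      ∥∥-elim ⊥ (⇒-elim (Π-elim ⊆dom-g a) (∥∥-intro (inj₂ (∥∥-intro refl)))) λ (b , ab∈g) →
      let p = ∥∥-intro (b , ⟨⟩-elim {T = T} g∈T ([-]-⊂ (graph g) ab∈g)) in
      ⇒-elim a∉dom (∥∥-intro (f (a , p) , ∥∥-intro (p , ∥∥-intro refl)))

theorem39 : {ℓ : Level} (𝒰 : PropUniverse ℓ) → let open Logic 𝒰 in
    ((A B : Set ℓ) (T : 𝒫 (List (A × B))) → Prf (DownwardPrime T) → Prf (GDC T)) →
    ((A B : Set ℓ) (T : 𝒫 (List (A × B))) → Prf (DownwardPrime T) → Prf (∃MPCF⁻ T))
theorem39 𝒰 gdc A B T prime =
  ⇒-intro λ h → ∥∥-elim _ h λ (α , α∈⟨T⟩) →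
  -- Totality of `R` is the second projection out of `Support T`.
  ∥∥-elim _ (choice R (gdc _ _ (_⊂ R) (DownwardPrime-intro (++-⊂ R))) (λ (_ , p) → p)) λ (f , f∈R) →
  ∥∥-intro (partial T f , ∥∥-intro
    -- The only use of `α`: the empty list is within it, so `[]` is in `T`.
    ( partial∈⟨⟩ T prime (⟨⟩-elim {T = T} α∈⟨T⟩ ([]-⊂ α)) f (Π-elim f∈R)
    , Π-intro λ g → ⇒-intro λ g≺f → ⇒-intro λ g∈T → partial-maximal T f g g≺f g∈T))
  where
  open Logic 𝒰
  open Choice 𝒰

  R : 𝒫 (Support T × B)
  R = onSupport T
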